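{- Let $G$ be a connected graph and let $q$ be a positive integer. If $G$ is bipartite, then $\mathcal{B}_q(G) = q+1$.
   Context: All graphs are simple. A graph is bipartite if its vertex set can be partitioned into two (possibly empty) sets such that every edge has one endpoint in each. A proper $k$-coloring of a graph $G$ is a function $c: V(G)\to\{1,\ldots,k\}$ such that $c(u)\neq c(v)$ for every $uv\in E(G)$ (not all colors need be used). Given a spanning subgraph $H$ of $G$ and positive integers $k$ and $q$, a $q$-backbone $k$-coloring of $(G,H)$ is a proper $k$-coloring $c$ of $G$ such that $|c(u)-c(v)|\ge q$ for every $uv\in E(H)$. The $q$-backbone chromatic number $BBC_q(G,H)$ is the smallest integer $k$ for which $(G,H)$ admits a $q$-backbone $k$-coloring. For a connected graph $G$ and a positive integer $q$, $\mathcal{B}_q(G) = \min\{BBC_q(G,T) : T \text{ is a spanning tree of } G\}$.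
   Formalization: The graph is assumed to have at least two vertices, since for the one-vertex graph the only spanning tree is itself and the minimum is 1, not q+1; graphs are finite with decidable adjacency. -}

module Defs where

open import Data.Fin.Base using (Fin; toℕ)
open import Data.Fin.Subset using (Subset; ∁; _∈_)
open import Data.List.Base using (List; _∷_; _∷ʳ_; length)
open import Data.List.Relation.Unary.Linked using (Linked)
open import Data.List.Relation.Unary.Unique.Propositional using (Unique)
open import Data.Nat.Base using (ℕ; _≤_; ∣_-_∣)
open import Data.Product.Base using (_×_; ∃-syntax)
open import Data.Sum.Base using (_⊎_)
open import Level using (0ℓ)
open import Relation.Binary.Construct.Closure.ReflexiveTransitive using (Star)
open import Relation.Binary.Core using (Rel; _⇒_)
open import Relation.Binary.Definitions using (Decidable; Irreflexive; Symmetric)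
open import Relation.Binary.PropositionalEquality.Core using (_≡_; _≢_)
open import Relation.Nullary.Negation.Core using (¬_)

-- Finite simple graphs. Decidability of adjacency is automatic classically.
record Graph (n : ℕ) : Set₁ where
  field
    Adj    : Rel (Fin n) 0ℓ
    Adj?   : Decidable Adj
    sym    : Symmetric Adj
    irrefl : Irreflexive _≡_ Adj

open Graph public using (Adj)

Connected : ∀ {n} → Graph n → Set
Connected G = ∀ u v → Star (Adj G) u v

Bipartite : ∀ {n} → Graph n → Set
Bipartite {n} G = ∃[ A ] (∀ {u v} → Adj G u v →
  (u ∈ A × v ∈ ∁ A) ⊎ (u ∈ ∁ A × v ∈ A))

-- The cycle v, v₁, …, vₘ, v is given by v and vs = v₁ ∷ … ∷ vₘ.
IsCycle : ∀ {n} → Graph n → Fin n → List (Fin n) → Set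
IsCycle G v vs = 2 ≤ length vs × Unique (v ∷ vs) × Linked (Adj G) (v ∷ (vs ∷ʳ v))

Acyclic : ∀ {n} → Graph n → Set
Acyclic G = ∀ v vs → ¬ IsCycle G v vs

-- Graphs on the same vertex set, so subgraphs here are spanning.
IsSpanningSubgraph : ∀ {n} → Graph n → Graph n → Set
IsSpanningSubgraph H G = Adj H ⇒ Adj G

IsSpanningTree : ∀ {n} → Graph n → Graph n → Set
IsSpanningTree T G = IsSpanningSubgraph T G × Connected T × Acyclic T

-- The colours 1, …, k are represented by 0, …, k - 1; only equality and
-- differences of colours matter.
IsProperColouring : ∀ {n} → Graph n → (k : ℕ) → (Fin n → Fin k) → Set
IsProperColouring G k c = ∀ {u v} → Adj G u v → c u ≢ c v

IsBackboneColouring : ∀ {n} → ℕ → Graph n → Graph n → (k : ℕ) → (Fin n → Fin k) → Set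
IsBackboneColouring q G H k c =
  IsProperColouring G k c ×
  (∀ {u v} → Adj H u v → q ≤ ∣ toℕ (c u) - toℕ (c v) ∣)

IsLeast : ∀ {ℓ} → (ℕ → Set ℓ) → ℕ → Set ℓ
IsLeast P m = P m × (∀ {k} → P k → m ≤ k)

-- BBC q G H k means BBC_q(G,H) = k.
BBC : ∀ {n} → ℕ → Graph n → Graph n → ℕ → Set
BBC q G H = IsLeast λ k → 1 ≤ k × ∃[ c ] IsBackboneColouring q G H k c

-- 𝓑 q G b means 𝓑_q(G) = b.
𝓑 : ∀ {n} → ℕ → Graph n → ℕ → Set₁
𝓑 q G = IsLeast λ k → ∃[ T ] (IsSpanningTree T G × BBC q G T k)

{-# OPTIONS --safe #-}

-- Colouring one side of the bipartition 0 and the other q is a q-backbone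
-- (q + 1)-colouring for every spanning tree, and any edge of a spanning tree
-- forces q + 1 colours. A spanning tree exists: in a breadth-first search,
-- join each vertex to a neighbour which is nearer to the root.
module Submission where

open import Defs
open import Data.Bool.Base using (if_then_else_)
open import Data.Fin.Base using (Fin; zero; suc; toℕ; fromℕ<)
open import Data.Fin.Properties using (_≟_; any?; toℕ<n; toℕ-fromℕ<)
open import Data.Fin.Subset using (∁; _∈_)
open import Data.Fin.Subset.Properties using (_∈?_; x∈∁p⇒x∉p)
open import Data.List.Base using ([]; _∷_; _∷ʳ_)
open import Data.List.Relation.Unary.All using (All; []; _∷_)
import Data.List.Relation.Unary.All as All
open import Data.List.Relation.Unary.All.Properties using (All¬⇒¬Any)
open import Data.List.Relation.Unary.AllPairs using (_∷_)
open import Data.List.Relation.Unary.Any using (Any; here; there)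
open import Data.List.Relation.Unary.Linked using (Linked; _∷_)
open import Data.List.Relation.Unary.Unique.Propositional using (Unique)
open import Data.Nat.Base using (ℕ; zero; suc; _+_; _≤_; _<_; z≤n; s≤s; ∣_-_∣)
open import Data.Nat.Induction using (<-wellFounded)
open import Data.Nat.Properties
  using (_<?_; ≤-reflexive; ≤-trans; ≤-<-trans; <-trans; <-asym; <-irrefl;
         +-comm; m≤n+m; ∣n-n∣≡0; ∣-∣-comm; ∣m-n∣≤m⊔n; ⊔-pres-<m)
open import Data.Product.Base using (_×_; _,_; ∃-syntax; proj₁; proj₂)
open import Data.Sum.Base using (_⊎_; inj₁; inj₂; swap)
open import Function.Base using (_∘_; id)
open import Induction.WellFounded using (Acc; acc)
open import Level using (0ℓ)
open import Relation.Binary.Construct.Closure.ReflexiveTransitive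
  using (Star; ε; _◅_; _◅◅_; reverse)
open import Relation.Binary.Core using (Rel)
import Relation.Binary.Definitions as Binary
open import Relation.Binary.PropositionalEquality
  using (_≡_; _≢_; refl; sym; trans; cong; cong₂; subst)
open import Relation.Nullary.Decidable using (yes; no; does; _×-dec_; _⊎-dec_; dec-true; dec-false)
open import Relation.Nullary.Negation using (¬_; contradiction)
open import Relation.Unary using (Pred; Decidable)

least : ∀ {ℓ} {P : Pred ℕ ℓ} → Decidable P → ∀ k → P k → ∃[ m ] IsLeast P m
least P? zero    p = zero , p , λ _ → z≤n
least P? (suc k) p with P? zero
... | yes p₀ = zero , p₀ , λ _ → z≤n
... | no ¬p₀ with least (P? ∘ suc) k p
...   | m , pₘ , min = suc m , pₘ , λ { {zero} p₀ → contradiction p₀ ¬p₀ ; {suc _} → s≤s ∘ min }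

-- A path in a rooted forest never ascends again once it has descended.
module RootedForest {n} (F : Graph n) (Parent : Rel (Fin n) 0ℓ) (depth : Fin n → ℕ)
  (orient : ∀ {x y} → Adj F x y → Parent x y ⊎ Parent y x)
  (parent-unique : ∀ {x x′ y} → Parent x y → Parent x′ y → x ≡ x′)
  (depth-mono : ∀ {x y} → Parent x y → depth x < depth y)
  where

  -- After the step down from `x` to `y`, a step up from `y` would lead to its only parent `x`,
  -- which is already used. So every later step goes down, and the last one enters `v` from a parent
  -- of `v`.
  descending : ∀ {x y v} ys → Parent x y → Unique (x ∷ y ∷ ys) →
    All (v ≢_) (x ∷ y ∷ ys) → Linked (Adj F) (y ∷ (ys ∷ʳ v)) →
    Any (λ w → Parent w v) (y ∷ ys) × depth x < depth v
  descending [] x↓y _ (v≢x ∷ _) (y~v ∷ _) with orient y~v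
  ... | inj₁ y↓v = here y↓v , <-trans (depth-mono x↓y) (depth-mono y↓v)
  ... | inj₂ v↓y = contradiction (parent-unique v↓y x↓y) v≢x
  descending (z ∷ zs) x↓y ((_ ∷ x≢z ∷ _) ∷ unique) (_ ∷ v∉) (y~z ∷ walk) with orient y~z
  ... | inj₂ z↓y = contradiction (parent-unique x↓y z↓y) x≢z
  ... | inj₁ y↓z with descending zs y↓z unique v∉ walk
  ...   | found , y<v = there found , <-trans (depth-mono x↓y) y<v

  -- Either the path climbs all the way to `v`, or it turns down at some point and `descending`
  -- takes over from there.
  arrival : ∀ {x v} xs → Unique (x ∷ xs) → All (v ≢_) (x ∷ xs) →
    Linked (Adj F) (x ∷ (xs ∷ʳ v)) → Any (λ w → Parent w v) (x ∷ xs) ⊎ depth v < depth x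
  arrival [] _ _ (x~v ∷ _) with orient x~v
  ... | inj₁ x↓v = inj₁ (here x↓v)
  ... | inj₂ v↓x = inj₂ (depth-mono v↓x)
  arrival (y ∷ ys) unique@(_ ∷ unique′) v∉@(_ ∷ v∉′) (x~y ∷ walk) with orient x~y
  ... | inj₁ x↓y = inj₁ (there (proj₁ (descending ys x↓y unique v∉ walk)))
  ... | inj₂ y↓x with arrival ys unique′ v∉′ walk
  ...   | inj₁ found = inj₁ (there found)
  ...   | inj₂ v<y   = inj₂ (<-trans v<y (depth-mono y↓x))

  no-other-parent : ∀ {x v xs} → Parent x v → All (x ≢_) xs → ¬ Any (λ w → Parent w v) xs
  no-other-parent x↓v = All¬⇒¬Any ∘ All.map (λ x≢w w↓v → x≢w (parent-unique x↓v w↓v))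

  acyclic : Acyclic F
  acyclic v []       (() , _)
  acyclic v (_ ∷ []) (s≤s () , _)
  acyclic v (x ∷ y ∷ ys)
    (_ , v∉@(_ ∷ v≢y ∷ _) ∷ unique@(x∉ ∷ unique′) , v~x ∷ x~y ∷ walk′)
    with orient v~x | orient x~y
  ... | inj₁ v↓x | inj₁ x↓y =
    <-asym (depth-mono v↓x) (proj₂ (descending ys x↓y unique v∉ walk′))
  ... | inj₁ v↓x | inj₂ y↓x = v≢y (parent-unique v↓x y↓x)
  ... | inj₂ x↓v | inj₁ x↓y =
    no-other-parent x↓v x∉ (proj₁ (descending ys x↓y unique v∉ walk′))
  ... | inj₂ x↓v | inj₂ y↓x with arrival ys unique′ (All.tail v∉) walk′
  ...   | inj₁ found = no-other-parent x↓v x∉ found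
  ...   | inj₂ v<y   = <-asym v<y (<-trans (depth-mono y↓x) (depth-mono x↓v))

module BreadthFirst {n} (G : Graph n) (connected : Connected G) (root : Fin n) where

  -- Walks start at the root and grow at the far end, so a nonempty walk to `v` exposes the vertex
  -- just before `v`.
  WalkOfLength : ℕ → Fin n → Set
  WalkOfLength zero    v = v ≡ root
  WalkOfLength (suc k) v = ∃[ w ] (WalkOfLength k w × Adj G w v)

  walkOfLength? : ∀ v → Decidable (λ k → WalkOfLength k v)
  walkOfLength? v zero    = v ≟ root
  walkOfLength? v (suc k) = any? λ w → walkOfLength? w k ×-dec Graph.Adj? G w v

  extend : ∀ {k u v} → WalkOfLength k u → Star (Adj G) u v → ∃[ l ] WalkOfLength l v
  extend walk ε           = _ , walk
  extend walk (u~w ◅ w⋯v) = extend (_ , walk , u~w) w⋯v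

  shortest : ∀ v → ∃[ d ] IsLeast (λ k → WalkOfLength k v) d
  shortest v with extend {zero} refl (connected root v)
  ... | l , walk = least (walkOfLength? v) l walk

  distance : Fin n → ℕ
  distance v = proj₁ (shortest v)

  nearer : ∀ v → ∃[ w ] (v ≡ root ⊎ (distance w < distance v × Adj G w v))
  nearer v with shortest v
  ... | zero  , v≡root , _           = v , inj₁ v≡root
  -- Dropping the last edge of a shortest walk leaves a walk of length `k` to `w`, so `w` has
  -- distance at most `k`.
  ... | suc k , (w , walk , w~v) , _ = w , inj₂ (s≤s (proj₂ (proj₂ (shortest w)) walk) , w~v)

  -- The value at the root is junk, which the other two conditions discard.
  Parent : Rel (Fin n) 0ℓ
  Parent x y = x ≡ proj₁ (nearer y) × distance x < distance y × Adj G x y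

  parent? : Binary.Decidable Parent
  parent? x y = (x ≟ proj₁ (nearer y)) ×-dec (distance x <? distance y) ×-dec Graph.Adj? G x y

  tree : Graph n
  tree = record
    { Adj    = λ x y → Parent x y ⊎ Parent y x
    ; Adj?   = λ x y → parent? x y ⊎-dec parent? y x
    ; sym    = swap
    ; irrefl = λ { refl (inj₁ (_ , x<x , _)) → <-irrefl refl x<x
                 ; refl (inj₂ (_ , x<x , _)) → <-irrefl refl x<x }
    }

  toRoot : ∀ v → Acc _<_ (distance v) → Star (Adj tree) v root
  -- The equation `eq` identifies `w` with the vertex that `Parent` selects for `v`.
  toRoot v (acc rec) with nearer v in eq
  ... | _ , inj₁ refl        = ε
  ... | w , inj₂ (w<v , w~v) =
    inj₂ (sym (cong proj₁ eq) , w<v , w~v) ◅ toRoot w (rec w<v)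

  tree-isSpanningTree : IsSpanningTree tree G
  tree-isSpanningTree = subgraph , tree-connected , acyclic
    where
    -- Parents are unique because `nearer` is a function, and the distance serves as depth.
    open RootedForest tree Parent distance id
      (λ (eq , _) (eq′ , _) → trans eq (sym eq′)) (λ (_ , x<y , _) → x<y)

    subgraph : IsSpanningSubgraph tree G
    subgraph (inj₁ (_ , _ , x~y)) = x~y
    subgraph (inj₂ (_ , _ , y~x)) = Graph.sym G y~x

    tree-connected : Connected tree
    tree-connected u v =
      toRoot u (<-wellFounded _) ◅◅ reverse swap (toRoot v (<-wellFounded _))

-- Every edge of `G` crosses between the two sides, so the gap `q` already holds on all of `G`.
-- Since `q` is positive, the colouring is also proper.
bipartite⇒backboneColouring : ∀ {n} {G H : Graph n} {q} → 1 ≤ q → Bipartite G →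
  IsSpanningSubgraph H G → ∃[ c ] IsBackboneColouring q G H (q + 1) c
bipartite⇒backboneColouring {n} {G} {H} {q} 1≤q (A , crosses) H⊆G =
  colour , proper , far ∘ H⊆G
  where
  0<q+1 : 0 < q + 1
  0<q+1 = m≤n+m 1 q

  q<q+1 : q < q + 1
  q<q+1 = ≤-reflexive (+-comm 1 q)

  colour : Fin n → Fin (q + 1)
  colour v = if does (v ∈? A) then fromℕ< 0<q+1 else fromℕ< q<q+1

  colour-∈ : ∀ {v} → v ∈ A → toℕ (colour v) ≡ 0
  colour-∈ {v} v∈A rewrite dec-true (v ∈? A) v∈A = toℕ-fromℕ< 0<q+1

  colour-∁ : ∀ {v} → v ∈ ∁ A → toℕ (colour v) ≡ q
  colour-∁ {v} v∈∁A rewrite dec-false (v ∈? A) (x∈∁p⇒x∉p v∈∁A) = toℕ-fromℕ< q<q+1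

  far-∈∁ : ∀ {u v} → u ∈ A → v ∈ ∁ A → q ≤ ∣ toℕ (colour u) - toℕ (colour v) ∣
  far-∈∁ u∈A v∈∁A = ≤-reflexive (sym (cong₂ ∣_-_∣ (colour-∈ u∈A) (colour-∁ v∈∁A)))

  far : ∀ {u v} → Adj G u v → q ≤ ∣ toℕ (colour u) - toℕ (colour v) ∣
  far {u} {v} u~v with crosses u~v
  ... | inj₁ (u∈A , v∈∁A) = far-∈∁ u∈A v∈∁A
  ... | inj₂ (u∈∁A , v∈A) =
    subst (q ≤_) (∣-∣-comm (toℕ (colour v)) (toℕ (colour u))) (far-∈∁ v∈A u∈∁A)

  proper : IsProperColouring G (q + 1) colour
  proper {u} {v} u~v cu≡cv = <-irrefl (sym gap≡0) (≤-trans 1≤q (far u~v))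
    where
    gap≡0 : ∣ toℕ (colour u) - toℕ (colour v) ∣ ≡ 0
    gap≡0 = trans (cong (λ i → ∣ toℕ i - toℕ (colour v) ∣) cu≡cv) (∣n-n∣≡0 (toℕ (colour v)))

-- A walk between two distinct vertices is nonempty and so has a first edge.
connected⇒edge : ∀ {n} {G : Graph n} → 2 ≤ n → Connected G → ∃[ u ] ∃[ v ] Adj G u v
connected⇒edge (s≤s (s≤s _)) connected with connected zero (suc zero)
... | u~v ◅ _ = _ , _ , u~v

-- The larger colour on an edge of `H` is at least `q`, yet below `k` because colours start at 0.
backboneColouring⇒q+1≤k : ∀ {n} {G H : Graph n} {q k c} → 2 ≤ n → Connected H →
  IsBackboneColouring q G H k c → q + 1 ≤ k
backboneColouring⇒q+1≤k {H = H} {q} {k} {c} 2≤n connected (_ , far)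
  with connected⇒edge {G = H} 2≤n connected
... | u , v , u~v = subst (_≤ k) (+-comm 1 q)
  (≤-<-trans (≤-trans (far u~v) (∣m-n∣≤m⊔n (toℕ (c u)) (toℕ (c v))))
             (⊔-pres-<m (toℕ<n (c u)) (toℕ<n (c v))))

-- The bound `2 ≤ n` guarantees an edge: on a single vertex one colour would suffice.
corollary1 : ∀ {n : ℕ} (G : Graph n) (q : ℕ) → 2 ≤ n → Connected G → 1 ≤ q →
    Bipartite G → 𝓑 q G (q + 1)
corollary1 {suc _} G q 2≤n connected 1≤q bipartite =
  (tree , tree-isSpanningTree ,
    (m≤n+m 1 q , bipartite⇒backboneColouring {G = G} {tree} 1≤q bipartite (proj₁ tree-isSpanningTree)) ,
    λ (_ , _ , colouring) →
      backboneColouring⇒q+1≤k {G = G} {tree} 2≤n (proj₁ (proj₂ tree-isSpanningTree)) colouring) ,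
  -- A value of `BBC` is attained by some colouring, so the lower bound applies to each spanning
  -- tree `T`.
  λ (T , (_ , T-connected , _) , (_ , _ , colouring) , _) →
    backboneColouring⇒q+1≤k {G = G} {T} 2≤n T-connected colouring
  where open BreadthFirst G connected zero
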